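{- Let $U$ be a set, let $G=(V,A)$ be a symmetric digraph with $V\subseteq U$ and $A\subseteq V\times V$ (that is, $(x,y)\in A$ implies $(y,x)\in A$), and let $w:U\times U\to\mathbb{R}$ satisfy $w(v_1,v_2)=w(v_2,v_1)$ for all $v_1,v_2\in U$. Then for every finite list $es=[(x_1,y_1),\ldots,(x_k,y_k)]$ of elements of $U\times U$, the list $es$ is an increasing trail of $(G,w)$ if and only if the list $[(y_k,x_k),\ldots,(y_1,x_1)]$, obtained by swapping the endpoints of every edge and reversing the order, is a decreasing trail of $(G,w)$.
   Context: A finite list $[a_1,\ldots,a_k]$ ($k\ge 0$) of pairs $a_i=(x_i,y_i)\in U\times U$ is a decreasing trail of $(G,w)$ if $a_i\in A$ for all $1\le i\le k$, and for all $1\le i<k$ one has $y_i=x_{i+1}$ and $w(a_i)>w(a_{i+1})$. It is an increasing trail of $(G,w)$ if the same holds with $w(a_i)<w(a_{i+1})$ in place of $w(a_i)>w(a_{i+1})$. The empty list is both a decreasing and an increasing trail. -}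

module Defs where

open import Data.List.Base using (List)
open import Data.List.Relation.Unary.All using (All)
open import Data.List.Relation.Unary.Linked using (Linked)
open import Data.Product.Base using (∃-syntax; _×_; _,_; proj₁; proj₂)
open import Data.Rational.Base as ℚ using (ℚ)
open import Data.Sum.Base using (_⊎_)
open import Level using (Level; 0ℓ; suc; _⊔_)
open import Relation.Binary.Core using (Rel)
open import Relation.Binary.PropositionalEquality.Core using (_≡_)
open import Relation.Nullary.Negation.Core using (¬_)
open import Relation.Unary using (Pred; _∈_; _⊆_; _≐_; _⟨×⟩_; Satisfiable)

private
  variable
    a v e ℓ : Level

-- The standard library has no real numbers; these are the (two-sided,
-- located) Dedekind reals.  Cuts are predicates, so equality of reals is
-- the relation _≈_ below, not _≡_.

record ℝ : Set₁ where
  field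
    lower upper     : Pred ℚ 0ℓ
    lower-inhabited : Satisfiable lower
    upper-inhabited : Satisfiable upper
    lower-closed    : ∀ {q r} → q ℚ.< r → r ∈ lower → q ∈ lower
    upper-closed    : ∀ {q r} → q ℚ.< r → q ∈ upper → r ∈ upper
    lower-open      : ∀ {q} → q ∈ lower → ∃[ r ] (q ℚ.< r × r ∈ lower)
    upper-open      : ∀ {r} → r ∈ upper → ∃[ q ] (q ℚ.< r × q ∈ upper)
    disjoint        : ∀ {q} → ¬ (q ∈ lower × q ∈ upper)
    located         : ∀ {q r} → q ℚ.< r → q ∈ lower ⊎ r ∈ upper

open ℝ public

infix 4 _≈_ _<_ _>_

_≈_ : Rel ℝ 0ℓ
x ≈ y = lower x ≐ lower y × upper x ≐ upper y

_<_ : Rel ℝ 0ℓ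
x < y = ∃[ q ] (q ∈ upper x × q ∈ lower y)

_>_ : Rel ℝ 0ℓ
x > y = y < x

record Digraph (U : Set a) (v e : Level) : Set (a ⊔ suc (v ⊔ e)) where
  field
    verts      : Pred U v
    arcs       : Pred (U × U) e
    arcs⊆verts : arcs ⊆ (verts ⟨×⟩ verts)

open Digraph public

SymmetricDigraph : {U : Set a} → Digraph U v e → Set (a ⊔ e)
SymmetricDigraph G = ∀ {x y} → (x , y) ∈ arcs G → (y , x) ∈ arcs G

SymmetricWeight : {U : Set a} → (U × U → ℝ) → Set a
SymmetricWeight w = ∀ v₁ v₂ → w (v₁ , v₂) ≈ w (v₂ , v₁)

Trail : {U : Set a} → Rel ℝ ℓ → Digraph U v e → (U × U → ℝ) →
        List (U × U) → Set (a ⊔ e ⊔ ℓ)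
Trail _∼_ G w es =
  All (_∈ arcs G) es ×
  Linked (λ a b → proj₂ a ≡ proj₁ b × w a ∼ w b) es

DecreasingTrail IncreasingTrail :
  {U : Set a} → Digraph U v e → (U × U → ℝ) → List (U × U) → Set (a ⊔ e)
DecreasingTrail = Trail _>_
IncreasingTrail = Trail _<_

{-# OPTIONS --safe #-}
module Submission where

open import Defs
open import Data.List.Base using (List; map; reverse; head; _ʳ++_)
open import Data.List.Properties using (map-∘; map-id; reverse-map; reverse-involutive)
open import Data.List.Relation.Binary.Permutation.Propositional using (↭-sym)
open import Data.List.Relation.Binary.Permutation.Propositional.Properties
  using (All-resp-↭; ↭-reverse)
import Data.List.Relation.Unary.All as All
import Data.List.Relation.Unary.All.Properties as All
open import Data.List.Relation.Unary.Linked as Linked using (Linked; []; [-]; _∷_; _∷′_)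
import Data.List.Relation.Unary.Linked.Properties as Linked
open import Data.Maybe.Relation.Binary.Connected using (Connected; just)
open import Data.Product.Base using (_×_; _,_; swap)
open import Function.Base using (flip; id)
open import Function.Bundles using (_⇔_; mk⇔)
open import Level using (Level)
open import Relation.Binary.Core using (Rel)
open import Relation.Binary.PropositionalEquality
  using (_≡_; cong; sym; subst; module ≡-Reasoning)

-- Reversal turns each consecutive pair of edges around, and swapping endpoints turns `y ≡ x′` into
-- a matching junction for the reversed pair; symmetry of `G` and `w` keeps arcs and weights. So
-- reverse-and-swap carries a trail for any relation respecting `_≈_` to one for the flipped
-- relation (`Trail-reverse-swap`). Both directions are instances of this, since the operation is an
-- involution and `flip _>_` unfolds to `_<_`.

private
  variable
    a v e ℓ : Level
    A : Set a

-- Generalises reversal to an accumulator `ys`, so that induction goes through: each step moves the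
-- head of `xs` onto `ys`, and the `Connected` premise records the one junction between them.
Linked-ʳ++⁺ : {R : Rel A ℓ} {xs ys : List A} → Linked R xs →
              Connected (flip R) (head xs) (head ys) →
              Linked (flip R) ys → Linked (flip R) (xs ʳ++ ys)
Linked-ʳ++⁺ []        _ Rys = Rys
Linked-ʳ++⁺ [-]       c Rys = c ∷′ Rys
Linked-ʳ++⁺ (r ∷ Rxs) c Rys = Linked-ʳ++⁺ Rxs (just r) (c ∷′ Rys)

Linked-reverse⁺ : {R : Rel A ℓ} {xs : List A} →
                  Linked R xs → Linked (flip R) (reverse xs)
Linked-reverse⁺ []        = []
Linked-reverse⁺ [-]       = [-]
Linked-reverse⁺ (r ∷ Rxs) = Linked-ʳ++⁺ Rxs (just r) [-]

reverse-map-swap-involutive : (es : List (A × A)) →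
  reverse (map swap (reverse (map swap es))) ≡ es
reverse-map-swap-involutive es = begin
  reverse (map swap (reverse (map swap es))) ≡⟨ cong reverse (reverse-map swap (map swap es)) ⟩
  reverse (reverse (map swap (map swap es))) ≡⟨ reverse-involutive _ ⟩
  map swap (map swap es)                     ≡⟨ map-∘ es ⟨
  map id es                                  ≡⟨ map-id es ⟩
  es                                         ∎
  where open ≡-Reasoning

-- The same rational `q` separates the new pair.
<-resp-≈ : ∀ x x′ y y′ → x ≈ x′ → y ≈ y′ → x < y → x′ < y′
<-resp-≈ _ _ _ _ (_ , (upper⊆ , _)) ((lower⊆ , _) , _) (q , q∈upper , q∈lower) =
  q , upper⊆ q∈upper , lower⊆ q∈lower

Trail-reverse-swap : {U : Set a} (G : Digraph U v e) → SymmetricDigraph G →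
  (w : U × U → ℝ) → SymmetricWeight w →
  {_∼_ : Rel ℝ ℓ} → (∀ x x′ y y′ → x ≈ x′ → y ≈ y′ → x ∼ y → x′ ∼ y′) →
  ∀ es → Trail _∼_ G w es → Trail (flip _∼_) G w (reverse (map swap es))
Trail-reverse-swap G G-sym w w-sym ∼-resp-≈ es (es⊆arcs , linked) =
  All-resp-↭ (↭-sym (↭-reverse (map swap es))) (All.map⁺ (All.map G-sym es⊆arcs)) ,
  Linked-reverse⁺ (Linked.map⁺ (Linked.map
    -- `sym` because the swapped later edge now comes first and must end where the swapped earlier
    -- edge starts.
    (λ (y≡x′ , wa∼wb) → sym y≡x′ , ∼-resp-≈ _ _ _ _ (w-sym _ _) (w-sym _ _) wa∼wb) linked))

mainTheorem7 : ∀ {a v e} {U : Set a} (G : Digraph U v e) → SymmetricDigraph G →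
    (w : U × U → ℝ) → SymmetricWeight w →
    (es : List (U × U)) →
    IncreasingTrail G w es ⇔ DecreasingTrail G w (reverse (map swap es))
mainTheorem7 G G-sym w w-sym es = mk⇔
  (Trail-reverse-swap G G-sym w w-sym <-resp-≈ es)
  -- The lemma for `_>_` gives an increasing trail on the twice-transformed list, which is `es`.
  (λ t → subst (IncreasingTrail G w) (reverse-map-swap-involutive es)
    (Trail-reverse-swap G G-sym w w-sym (λ x x′ y y′ x≈x′ y≈y′ → <-resp-≈ y y′ x x′ y≈y′ x≈x′) _ t))
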